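{- Let $G$ be a connected graph of order $n_1\ge 2$ and let $H$ be any non-complete graph of order $n_2$. Then $$g(G\odot H)\le s(G\odot H).$$
   Context: Graphs are finite, simple, with nonempty vertex set. The order of a graph is its number of vertices. $H$ need not be connected. Corona product: if $G$ has vertices $v_1,\dots,v_{n_1}$, then $G\odot H$ is obtained from one copy of $G$ and $n_1$ disjoint copies $H_1,\dots,H_{n_1}$ of $H$ by joining $v_i$ to every vertex of $H_i$, for each $i$. Geodetic number: in a connected graph $F$ with vertex set $V(F)$, $I_F[u,v]$ is the set of all vertices lying on some shortest $u$-$v$ path of $F$ (so $I_F[u,u]=\{u\}$), and $I_F[S]=\bigcup_{u,v\in S}I_F[u,v]$ for nonempty $S\subseteq V(F)$. $S$ is a geodetic set of $F$ if $I_F[S]=V(F)$. The geodetic number $g(F)$ is the minimum cardinality of a geodetic set of $F$. Steiner number: for nonempty $W\subseteq V(F)$, a Steiner $W$-tree is a connected subgraph of $F$ containing $W$ with the minimum possible number of edges (necessarily a tree). $S_F[W]$ is the set of all vertices of $F$ lying on some Steiner $W$-tree. $W$ is a Steiner set of $F$ if $S_F[W]=V(F)$. The Steiner number $s(F)$ is the minimum cardinality of a Steiner set of $F$. -}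

module Defs where

open import Data.Empty using (⊥-elim)
open import Data.Fin using (Fin; splitAt; remQuot; combine; _↑ˡ_; _<_)
open import Data.Fin.Properties
  using (any?; all?; _≟_; _<?_; <-cmp; injective⇒≤; splitAt-↑ˡ; splitAt⁻¹-↑ˡ;
         remQuot-combine)
open import Data.Fin.Subset using (Subset; Nonempty; _∈_; _⊆_; ∣_∣; ⊤; inside)
open import Data.Fin.Subset.Properties using (_∈?_; _⊆?_; nonempty?; anySubset?; ∈⊤; ⊆⊤)
open import Data.List using (List; []; _∷_)
import Data.List as List
open import Data.List.Properties using (≡-dec)
open import Data.List.Membership.Propositional.Properties using (∈-lookup)
open import Data.List.Membership.Propositional using () renaming (_∈_ to _∈ˡ_)
import Data.List.Membership.DecPropositional as DecMembership
open import Data.List.Relation.Unary.All.Properties using (¬Any⇒All¬)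
open import Data.List.Relation.Unary.AllPairs using ([]; _∷_)
import Data.List.Relation.Unary.All as All
open import Data.List.Relation.Unary.All using ([])
open import Data.List.Relation.Unary.Any using (here; there)
open import Data.List.Relation.Unary.Unique.Propositional using (Unique)
import Data.List.Relation.Unary.Unique.DecPropositional as DecUnique
open import Data.Nat using (ℕ; zero; suc; _+_; _*_; _≤_; s≤s; z≤n; NonZero; >-nonZero)
import Data.Nat as ℕ
import Data.Nat.Properties as ℕ
open import Data.Product using (Σ; ∃; ∃-syntax; _×_; _,_; proj₁; proj₂)
open import Data.Sum using (_⊎_; inj₁; inj₂)
import Data.Sum as Sum
open import Data.Vec using (tabulate)
open import Data.Vec.Properties using (lookup∘tabulate; lookup⇒[]=; []=⇒lookup)
open import Function using (_∘_)
open import Level using (0ℓ)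
open import Relation.Binary using (Rel; Decidable; Symmetric; Irreflexive; tri<; tri≈; tri>)
open import Relation.Binary.Construct.Closure.ReflexiveTransitive
  using (Star; ε; _◅_; _◅◅_; return; map; gmap; reverse)
open import Relation.Binary.PropositionalEquality
  using (_≡_; _≢_; refl; sym; trans; cong; subst)
import Relation.Unary as U
open import Relation.Nullary using (¬_; Dec; yes; no; does; ¬?; _×-dec_; _⊎-dec_; _→-dec_)
open import Relation.Nullary.Decidable using (map′; dec-true)

record Graph : Set₁ where
  field
    order        : ℕ
    {{nonEmpty}} : NonZero order

  Vertex : Set
  Vertex = Fin order

  field
    Adj    : Rel Vertex 0ℓ
    adj?   : Decidable Adj
    symm   : Symmetric Adj
    irrefl : Irreflexive _≡_ Adj

open Graph public using (order; Vertex; Adj)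

Complete : Graph → Set
Complete G = ∀ {u v : Vertex G} → u ≢ v → Adj G u v

-- `Star R u v` is the type of walks from u to v along R.

Connected : Graph → Set
Connected G = ∀ (u v : Vertex G) → Star (Adj G) u v

-- With n₁ = order G and n₂ = order H, the vertices are Fin (n₁ + n₁ * n₂): the
-- first n₁ are those of G, the others are pairs (i , h), vertex h of copy i of H.

module _ (G H : Graph) where

  CoronaVertex : Set
  CoronaVertex = Vertex G ⊎ (Vertex G × Vertex H)

  CoronaAdj : Rel CoronaVertex 0ℓ
  CoronaAdj (inj₁ i)       (inj₁ j)       = Adj G i j
  CoronaAdj (inj₁ i)       (inj₂ (j , _)) = i ≡ j
  CoronaAdj (inj₂ (i , _)) (inj₁ j)       = i ≡ j
  CoronaAdj (inj₂ (i , h)) (inj₂ (j , k)) = i ≡ j × Adj H h k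

  coronaView : Fin (order G + order G * order H) → CoronaVertex
  coronaView = Sum.map₂ (remQuot (order H)) ∘ splitAt (order G)

  private
    coronaAdj? : Decidable CoronaAdj
    coronaAdj? (inj₁ i)       (inj₁ j)       = Graph.adj? G i j
    coronaAdj? (inj₁ i)       (inj₂ (j , _)) = i ≟ j
    coronaAdj? (inj₂ (i , _)) (inj₁ j)       = i ≟ j
    coronaAdj? (inj₂ (i , h)) (inj₂ (j , k)) = (i ≟ j) ×-dec Graph.adj? H h k

    coronaSym : Symmetric CoronaAdj
    coronaSym {inj₁ _} {inj₁ _} e       = Graph.symm G e
    coronaSym {inj₁ _} {inj₂ _} e       = sym e
    coronaSym {inj₂ _} {inj₁ _} e       = sym e
    coronaSym {inj₂ _} {inj₂ _} (p , e) = sym p , Graph.symm H e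

    coronaIrrefl : ∀ x → ¬ CoronaAdj x x
    coronaIrrefl (inj₁ _) e       = Graph.irrefl G refl e
    coronaIrrefl (inj₂ _) (_ , e) = Graph.irrefl H refl e

  infixr 7 _⊙_

  _⊙_ : Graph
  _⊙_ = record
    { order    = order G + order G * order H
    ; nonEmpty = >-nonZero (ℕ.<-≤-trans (ℕ.>-nonZero⁻¹ (order G)) (ℕ.m≤m+n _ _))
    ; Adj      = λ x y → CoronaAdj (coronaView x) (coronaView y)
    ; adj?     = λ x y → coronaAdj? (coronaView x) (coronaView y)
    ; symm     = λ {x} {y} → coronaSym {coronaView x} {coronaView y}
    ; irrefl   = λ { {x} refl → coronaIrrefl (coronaView x) }
    }

  private
    base : Vertex G → Vertex _⊙_
    base i = i ↑ˡ (order G * order H)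

    view-base : ∀ i → coronaView (base i) ≡ inj₁ i
    view-base i = cong (Sum.map₂ (remQuot (order H))) (splitAt-↑ˡ (order G) i _)

    base-adj : ∀ {i j} → Adj G i j → Adj _⊙_ (base i) (base j)
    base-adj {i} {j} e rewrite view-base i | view-base j = e

    toBase : ∀ x → ∃[ i ] Star (Adj _⊙_) x (base i)
    toBase x = go (coronaView x) refl
      where
      go : ∀ c → coronaView x ≡ c → ∃[ i ] Star (Adj _⊙_) x (base i)
      go (inj₂ (i , h)) eq = i , return step
        where
        step : CoronaAdj (coronaView x) (coronaView (base i))
        step rewrite eq | view-base i = refl
      go (inj₁ i) eq = i , subst (Star (Adj _⊙_) x) x≡ ε
        where
        inv : ∀ s → Sum.map₂ (remQuot {order G} (order H)) s ≡ inj₁ i → s ≡ inj₁ i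
        inv (inj₁ _) refl = refl
        x≡ : x ≡ base i
        x≡ = sym (splitAt⁻¹-↑ˡ (inv (splitAt (order G) x) eq))

  ⊙-connected : Connected G → Connected _⊙_
  ⊙-connected conn x y =
    let (i , p) = toBase x
        (j , q) = toBase y
    in  p ◅◅ gmap base base-adj (conn i j)
          ◅◅ reverse (λ {u} {v} → Graph.symm _⊙_ {u} {v}) q

module _ {V : Set} {R : Rel V 0ℓ} where

  vertices : ∀ {u v} → Star R u v → List V
  vertices {u} ε       = u ∷ []
  vertices {u} (_ ◅ p) = u ∷ vertices p

  length : ∀ {u v} → Star R u v → ℕ
  length ε       = 0
  length (_ ◅ p) = suc (length p)

  length-vertices : ∀ {u v} (p : Star R u v) → List.length (vertices p) ≡ suc (length p)
  length-vertices ε       = refl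
  length-vertices (_ ◅ p) = cong suc (length-vertices p)

  length-<⁺ : ∀ {u v u′ v′} (p : Star R u v) (q : Star R u′ v′) → length p ℕ.< length q →
              List.length (vertices p) ℕ.< List.length (vertices q)
  length-<⁺ p q l rewrite length-vertices p | length-vertices q = s≤s l

  length-<⁻ : ∀ {u v u′ v′} (p : Star R u v) (q : Star R u′ v′) →
              List.length (vertices p) ℕ.< List.length (vertices q) → length p ℕ.< length q
  length-<⁻ p q l rewrite length-vertices p | length-vertices q = ℕ.≤-pred l

  IsPath : ∀ {u v} → Star R u v → Set
  IsPath p = Unique (vertices p)

  IsShortestPath : ∀ {u v} → Star R u v → Set
  IsShortestPath {u} {v} p =
    IsPath p × (∀ (q : Star R u v) → IsPath q → length p ≤ length q)

IsMinimumCardinality : ∀ {n} → (Subset n → Set) → ℕ → Set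
IsMinimumCardinality P k =
  (∃[ S ] P S × ∣ S ∣ ≡ k) × (∀ S → P S → k ≤ ∣ S ∣)

module _ (F : Graph) where

  -- w ∈ I_F[u,v]
  InInterval : (u v w : Vertex F) → Set
  InInterval u v w = Σ (Star (Adj F) u v) λ p → IsShortestPath p × w ∈ˡ vertices p

  IsGeodeticSet : Subset (order F) → Set
  IsGeodeticSet S =
    Nonempty S × (∀ w → ∃[ u ] ∃[ v ] u ∈ S × v ∈ S × InInterval u v w)

-- An edge {u , v} with u < v is stored as the single element `combine u v`
-- of Fin (n * n), so `∣ edges ∣` counts unordered edges.

record Subgraph (F : Graph) : Set where
  field
    verts : Subset (order F)
    edges : Subset (order F * order F)
    valid : ∀ u v → combine u v ∈ edges → u < v × Adj F u v × u ∈ verts × v ∈ verts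

  size : ℕ
  size = ∣ edges ∣

open Subgraph public using (verts; edges; size)

Joined : ∀ {n} → Subset (n * n) → Rel (Fin n) 0ℓ
Joined E u v = combine u v ∈ E ⊎ combine v u ∈ E

ConnectedSubgraph : {F : Graph} → Subgraph F → Set
ConnectedSubgraph T =
  ∀ u v → u ∈ verts T → v ∈ verts T → Star (Joined (edges T)) u v

module _ (F : Graph) where

  IsSteinerTree : Subset (order F) → Subgraph F → Set
  IsSteinerTree W T =
    ConnectedSubgraph T × W ⊆ verts T ×
    (∀ (T′ : Subgraph F) → ConnectedSubgraph T′ → W ⊆ verts T′ → size T ≤ size T′)

  -- w ∈ S_F[W]
  InSteinerInterval : Subset (order F) → Vertex F → Set
  InSteinerInterval W w = Σ (Subgraph F) λ T → IsSteinerTree W T × w ∈ verts T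

  IsSteinerSet : Subset (order F) → Set
  IsSteinerSet W = Nonempty W × (∀ w → InSteinerInterval W w)

least : {P : ℕ → Set} → U.Decidable P → ∀ n → P n →
        ∃[ k ] P k × (∀ j → P j → k ≤ j)
least {P} P? zero    pn = zero , pn , λ _ _ → z≤n
least {P} P? (suc n) pn with P? 0
... | yes p0 = zero , p0 , λ _ _ → z≤n
... | no ¬p0 with least (P? ∘ suc) n pn
...   | k , pk , min = suc k , pk , min′
  where
  min′ : ∀ j → P j → suc k ≤ j
  min′ zero    p0 = ⊥-elim (¬p0 p0)
  min′ (suc j) pj = s≤s (min j pj)

minimumCardinality : ∀ {n} {P : Subset n → Set} → U.Decidable P → ∃ P →
                     ∃[ k ] IsMinimumCardinality P k
minimumCardinality P? (S , pS)
  with least (λ k → anySubset? (λ S → P? S ×-dec (∣ S ∣ ℕ.≟ k))) ∣ S ∣ (S , pS , refl)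
... | k , wit , min = k , wit , λ S pS → min ∣ S ∣ (S , pS , refl)

private
  bounded? : ∀ {n} {Q : List (Fin n) → Set} → U.Decidable Q →
             ∀ b → Dec (∃[ xs ] List.length xs ≤ b × Q xs)
  bounded? Q? b with Q? []
  bounded? Q? b       | yes q  = yes ([] , z≤n , q)
  bounded? Q? zero    | no ¬q = no λ { ([] , _ , q) → ¬q q }
  bounded? Q? (suc b) | no ¬q =
    map′ (λ { (x , xs , l , q) → x ∷ xs , s≤s l , q })
         (λ { ([] , _ , q) → ⊥-elim (¬q q) ; (x ∷ xs , s≤s l , q) → x , xs , l , q })
         (any? λ x → bounded? (Q? ∘ (x ∷_)) b)

  lookup-injective : ∀ {A : Set} {xs : List A} → Unique xs → ∀ i j →
                     List.lookup xs i ≡ List.lookup xs j → i ≡ j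
  lookup-injective (_ ∷ _)  Fin.zero    Fin.zero    _  = refl
  lookup-injective (x∉ ∷ _) Fin.zero    (Fin.suc j) eq = ⊥-elim (All.lookup x∉ (∈-lookup j) eq)
  lookup-injective (x∉ ∷ _) (Fin.suc i) Fin.zero    eq = ⊥-elim (All.lookup x∉ (∈-lookup i) (sym eq))
  lookup-injective (_ ∷ u)  (Fin.suc i) (Fin.suc j) eq = cong Fin.suc (lookup-injective u i j eq)

  unique-length : ∀ {n} {xs : List (Fin n)} → Unique xs → List.length xs ≤ n
  unique-length u = injective⇒≤ (λ {i} {j} → lookup-injective u i j)

module _ {n} {R : Rel (Fin n) 0ℓ} (R? : Decidable R) where

  open DecMembership (_≟_ {n}) using () renaming (_∈?_ to _∈ˡ?_)
  open DecUnique (_≟_ {n}) using (unique?)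

  private
    realise? : ∀ u v xs → Dec (Σ (Star R u v) λ p → vertices p ≡ xs)
    realise? u v [] = no λ { (ε , ()) ; (_ ◅ _ , ()) }
    realise? u v (x ∷ xs) =
      map′ (λ { (refl , inj₁ (refl , refl))          → ε , refl
              ; (refl , inj₂ (_ , r , (p , refl))) → r ◅ p , refl })
           (λ { (ε , refl)     → refl , inj₁ (refl , refl)
              ; (r ◅ p , refl) → refl , inj₂ (_ , r , (p , refl)) })
           ((u ≟ x) ×-dec (((u ≟ v) ×-dec ≡-dec _≟_ xs []) ⊎-dec
             any? λ y → R? u y ×-dec realise? y v xs))

  anyPath? : {Q : List (Fin n) → Set} → U.Decidable Q → ∀ u v →
             Dec (Σ (Star R u v) λ p → IsPath p × Q (vertices p))
  anyPath? Q? u v =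
    map′ (λ { (_ , _ , (p , refl) , r) → p , r })
         (λ { (p , up , q) → vertices p , unique-length up , (p , refl) , up , q })
         (bounded? (λ xs → realise? u v xs ×-dec (unique? xs ×-dec Q? xs)) n)

  private
    suffix : ∀ {u v w} (p : Star R v w) → IsPath p → u ∈ˡ vertices p →
             Σ (Star R u w) IsPath
    suffix ε       up       (here refl) = ε , up
    suffix (r ◅ p) up       (here refl) = r ◅ p , up
    suffix (r ◅ p) (_ ∷ up) (there m)   = suffix p up m

  toPath : ∀ {u v} → Star R u v → Σ (Star R u v) IsPath
  toPath ε = ε , [] ∷ []
  toPath {u} (r ◅ p) with toPath p
  ... | q , uq with u ∈ˡ? vertices q
  ...   | yes m = suffix q uq m
  ...   | no ¬m = r ◅ q , ¬Any⇒All¬ _ ¬m ∷ uq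

  star? : Decidable (Star R)
  star? u v =
    map′ proj₁ (λ p → let (q , uq) = toPath p in q , uq , z≤n)
         (anyPath? {Q = λ _ → 0 ≤ 0} (λ _ → yes z≤n) u v)

  onShortestPath? : ∀ u v w →
    Dec (Σ (Star R u v) λ p → IsShortestPath p × w ∈ˡ vertices p)
  onShortestPath? u v w =
    map′ to from (anyPath? (λ xs → ¬? (shorter? xs) ×-dec (w ∈ˡ? xs)) u v)
    where
    Shorter : List (Fin n) → Set
    Shorter xs = Σ (Star R u v) λ q →
                 IsPath q × List.length (vertices q) ℕ.< List.length xs

    shorter? : U.Decidable Shorter
    shorter? xs = anyPath? (λ ys → List.length ys ℕ.<? List.length xs) u v

    to : (Σ (Star R u v) λ p → IsPath p × ¬ Shorter (vertices p) × w ∈ˡ vertices p) →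
         Σ (Star R u v) λ p → IsShortestPath p × w ∈ˡ vertices p
    to (p , up , min , m) = p , (up , λ q uq → ℕ.≮⇒≥ λ q<p → min (q , uq , length-<⁺ q p q<p)) , m

    from : (Σ (Star R u v) λ p → IsShortestPath p × w ∈ˡ vertices p) →
           Σ (Star R u v) λ p → IsPath p × ¬ Shorter (vertices p) × w ∈ˡ vertices p
    from (p , (up , min) , m) = p , up , (λ { (q , uq , l) → ℕ.<⇒≱ (length-<⁻ q p l) (min q uq) }) , m

module _ (F : Graph) where

  isGeodeticSet? : U.Decidable (IsGeodeticSet F)
  isGeodeticSet? S =
    nonempty? S ×-dec all? λ w → any? λ u → any? λ v →
      (u ∈? S) ×-dec (v ∈? S) ×-dec onShortestPath? (Graph.adj? F) u v w

  private
    n : ℕ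
    n = order F

    Valid : Subset n → Subset (n * n) → Set
    Valid V E = ∀ u v → combine u v ∈ E → u < v × Adj F u v × u ∈ V × v ∈ V

    Conn : Subset n → Subset (n * n) → Set
    Conn V E = ∀ u v → u ∈ V → v ∈ V → Star (Joined E) u v

    valid? : Decidable Valid
    valid? V E = all? λ u → all? λ v → (combine u v ∈? E) →-dec
      ((u <? v) ×-dec Graph.adj? F u v ×-dec (u ∈? V) ×-dec (v ∈? V))

    conn? : Decidable Conn
    conn? V E = all? λ u → all? λ v → (u ∈? V) →-dec ((v ∈? V) →-dec
      star? (λ x y → (combine x y ∈? E) ⊎-dec (combine y x ∈? E)) u v)

    anySubgraph? : {Q : Subset n → Subset (n * n) → Set} → Decidable Q →
                   Dec (Σ (Subgraph F) λ T → Q (verts T) (edges T))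
    anySubgraph? Q? =
      map′ (λ { (V , E , val , q) → record { verts = V ; edges = E ; valid = val } , q })
           (λ { (T , q) → verts T , edges T , Subgraph.valid T , q })
           (anySubset? λ V → anySubset? λ E → valid? V E ×-dec Q? V E)

    record Spans (W V : Subset n) (E : Subset (n * n)) : Set where
      constructor mkSpans
      field
        connected : Conn V E
        contains  : W ⊆ V

    spans? : ∀ W → Decidable (Spans W)
    spans? W V E = map′ to from (conn? V E ×-dec (W ⊆? V))
      where
      to : Conn V E × W ⊆ V → Spans W V E
      to (c , s) = mkSpans c s
      from : Spans W V E → Conn V E × W ⊆ V
      from (mkSpans c s) = c , s

    Smaller : Subset n → Subset (n * n) → Set
    Smaller W E = Σ (Subgraph F) λ T → Spans W (verts T) (edges T) × size T ℕ.< ∣ E ∣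

    smaller? : ∀ W → U.Decidable (Smaller W)
    smaller? W E = anySubgraph? λ V′ E′ → spans? W V′ E′ ×-dec (∣ E′ ∣ ℕ.<? ∣ E ∣)

  inSteinerInterval? : ∀ W w → Dec (InSteinerInterval F W w)
  inSteinerInterval? W w =
    map′ (λ { (T , mkSpans c s , min , m) → T , (c , s , λ T′ c′ s′ →
                ℕ.≮⇒≥ λ l → min (T′ , mkSpans c′ s′ , l)) , m })
         (λ { (T , (c , s , min) , m) → T , mkSpans c s ,
                (λ { (T′ , mkSpans c′ s′ , l) → ℕ.<⇒≱ l (min T′ c′ s′) }) , m })
         (anySubgraph? λ V E → spans? W V E ×-dec ¬? (smaller? W E) ×-dec (w ∈? V))

  isSteinerSet? : U.Decidable (IsSteinerSet F)
  isSteinerSet? W = nonempty? W ×-dec all? (inSteinerInterval? W)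

  private
    someVertex : Vertex F
    someVertex = pick (order F)
      where
      pick : ∀ m → {{NonZero m}} → Fin m
      pick (suc _) = Fin.zero

  ⊤-geodetic : IsGeodeticSet F ⊤
  ⊤-geodetic = (someVertex , ∈⊤) , λ w →
    w , w , ∈⊤ , ∈⊤ , ε , ([] ∷ [] , λ _ _ → z≤n) , here refl

  private
    IsEdge : Fin n × Fin n → Set
    IsEdge (u , v) = u < v × Adj F u v

    isEdge? : U.Decidable IsEdge
    isEdge? (u , v) = (u <? v) ×-dec Graph.adj? F u v

    allEdges : Subset (n * n)
    allEdges = tabulate (λ e → does (isEdge? (remQuot n e)))

    ∈allEdges : ∀ {u v} → u < v → Adj F u v → combine u v ∈ allEdges
    ∈allEdges {u} {v} l e = lookup⇒[]= (combine u v) allEdges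
      (trans (lookup∘tabulate _ (combine u v))
        (dec-true (isEdge? _) (subst IsEdge (sym (remQuot-combine u v)) (l , e))))

    does⇒ : ∀ {P : Set} (d : Dec P) → does d ≡ inside → P
    does⇒ (yes p) _ = p

    allEdges⇒ : ∀ u v → combine u v ∈ allEdges → IsEdge (u , v)
    allEdges⇒ u v m = subst IsEdge (remQuot-combine u v)
      (does⇒ (isEdge? _) (trans (sym (lookup∘tabulate _ (combine u v))) ([]=⇒lookup m)))

    whole : Subgraph F
    whole = record
      { verts = ⊤
      ; edges = allEdges
      ; valid = λ u v m → let (l , e) = allEdges⇒ u v m in l , e , ∈⊤ , ∈⊤
      }

    joined : ∀ {u v} → Adj F u v → Joined allEdges u v
    joined {u} {v} e with <-cmp u v
    ... | tri< l _ _    = inj₁ (∈allEdges l e)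
    ... | tri≈ _ refl _ = ⊥-elim (Graph.irrefl F refl e)
    ... | tri> _ _ l    = inj₂ (∈allEdges l (Graph.symm F e))

  steinerTree-exists : Connected F → ∀ W → Σ (Subgraph F) (IsSteinerTree F W)
  steinerTree-exists conn W
    with least (λ k → anySubgraph? λ V E → spans? W V E ×-dec (∣ E ∣ ℕ.≟ k))
               (size whole) (whole , mkSpans (λ u v _ _ → map joined (conn u v)) ⊆⊤ , refl)
  ... | _ , (T , mkSpans c s , refl) , min =
    T , c , s , λ T′ c′ s′ → min _ (T′ , mkSpans c′ s′ , refl)

  ⊤-steiner : Connected F → IsSteinerSet F ⊤
  ⊤-steiner conn = (someVertex , ∈⊤) , λ w →
    let (T , st@(_ , s , _)) = steinerTree-exists conn ⊤ in T , st , s ∈⊤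

  geodetic-minimum : ∃[ k ] IsMinimumCardinality (IsGeodeticSet F) k
  geodetic-minimum = minimumCardinality isGeodeticSet? (⊤ , ⊤-geodetic)

  geodeticNumber : ℕ
  geodeticNumber = proj₁ geodetic-minimum

  steiner-minimum : Connected F → ∃[ k ] IsMinimumCardinality (IsSteinerSet F) k
  steiner-minimum conn = minimumCardinality isSteinerSet? (⊤ , ⊤-steiner conn)

  steinerNumber : Connected F → ℕ
  steinerNumber conn = proj₁ (steiner-minimum conn)

{-# OPTIONS --safe #-}
module Submission where

-- Every Steiner set W of G ⊙ H already contains every vertex of every copy of H.
-- Suppose a Steiner W-tree passes through a vertex x ∉ W of copy i and through the
-- vertex i of G. Root the tree at i; every child of x is adjacent to i, so the
-- children of x can be hung on i and x deleted, which saves an edge. The vertex i is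
-- on the tree as soon as W has a vertex w outside copy i, as i cuts off that copy. So W
-- contains every copy that misses w, and then, using one of these, the remaining one.
-- Hence W is geodetic: a vertex i of G lies on every path from copy i to another copy.

open import Defs
open import Data.Fin using (Fin; zero; suc; combine; remQuot; join; splitAt; _↑ˡ_; _↑ʳ_)
  renaming (_<_ to _<ᶠ_)
open import Data.Fin.Properties
  using (_≟_; _<?_; <-cmp; any?; combine-injective; splitAt-↑ˡ; splitAt-↑ʳ; join-splitAt;
         remQuot-combine; combine-remQuot; suc-injective)
  renaming (<-asym to <ᶠ-asym)
open import Data.Fin.Subset using (Subset; inside; outside; _∈_; _∉_; _-_; ∣_∣)
open import Data.Fin.Subset.Properties
  using (_∈?_; p─q⊆p; x∈p∧x≢y⇒x∈p-y; p─x─y≡p─y─x; x∈p⇒∣p-x∣<∣p∣)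
import Data.List as List
open import Data.List.Membership.Propositional using () renaming (_∈_ to _∈ˡ_)
open import Data.List.Relation.Unary.All using ([])
open import Data.List.Relation.Unary.AllPairs using ([]; _∷_)
open import Data.List.Relation.Unary.Any using (here; there)
open import Data.Nat using (ℕ; zero; suc; _*_; _≤_; _<_; z≤n; s≤s; NonZero)
import Data.Nat as ℕ
open import Data.Nat.Induction using (<-wellFounded)
import Data.Nat.Properties as ℕ
open import Data.Product using (Σ; ∃; ∃-syntax; _×_; _,_; proj₁; proj₂)
open import Data.Sum using (_⊎_; inj₁; inj₂; swap)
import Data.Sum as Sum
open import Data.Vec using ([]; _∷_; tabulate; here; there)
open import Data.Vec.Properties using (lookup∘tabulate; lookup⇒[]=; []=⇒lookup)
open import Function using (_∘_)
open import Induction.WellFounded using (Acc; acc)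
open import Level using (0ℓ)
open import Relation.Binary using (Rel; REL; Decidable; tri<; tri≈; tri>)
open import Relation.Binary.Construct.Closure.ReflexiveTransitive
  using (Star; ε; _◅_; _◅◅_; reverse)
open import Relation.Binary.PropositionalEquality
  using (_≡_; _≢_; refl; sym; trans; cong; subst; subst₂)
open import Relation.Nullary
  using (¬_; yes; no; does; contradiction; _×-dec_; _⊎-dec_)
open import Relation.Nullary.Decidable using (dec-true; decidable-stable)
import Relation.Unary as U

-- Finite subsets: deletion, comparison of cardinalities, comprehension.

x∉p-x : ∀ {n} (p : Subset n) x → x ∉ p - x
x∉p-x (inside  ∷ p) zero    ()
x∉p-x (outside ∷ p) zero    ()
x∉p-x (_ ∷ p)       (suc x) (there x∈) = x∉p-x p x x∈

x∈p-y⇒x≢y : ∀ {n} {p : Subset n} {x y} → x ∈ p - y → x ≢ y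
x∈p-y⇒x≢y {p = p} {x} x∈ refl = x∉p-x p x x∈

-- Pigeonhole by induction on `p`: the partner of the first element is deleted from `q`, and left
-- uniqueness keeps later elements from needing it. A relation instead of a function lets the
-- partner depend on the membership proof.
left-unique⇒∣∣≤ : ∀ {m n} {R : REL (Fin m) (Fin n) 0ℓ} (p : Subset m) (q : Subset n) →
  (∀ {x} → x ∈ p → ∃[ y ] y ∈ q × R x y) →
  (∀ {x x′ y} → R x y → R x′ y → x ≡ x′) → ∣ p ∣ ≤ ∣ q ∣
left-unique⇒∣∣≤ []            q total unique = z≤n
left-unique⇒∣∣≤ (outside ∷ p) q total unique =
  left-unique⇒∣∣≤ p q (total ∘ there) (λ r r′ → suc-injective (unique r r′))
left-unique⇒∣∣≤ {R = R} (inside ∷ p) q total unique =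
  ℕ.≤-<-trans (left-unique⇒∣∣≤ p (q - y₀) total′ λ r r′ → suc-injective (unique r r′))
              (x∈p⇒∣p-x∣<∣p∣ (proj₁ (proj₂ (total here))))
  where
  y₀ = proj₁ (total here)
  r₀ = proj₂ (proj₂ (total here))
  total′ : ∀ {x} → x ∈ p → ∃[ y ] y ∈ q - y₀ × R (suc x) y
  total′ x∈p with total (there x∈p)
  ... | y , y∈q , r =
    y , x∈p∧x≢y⇒x∈p-y y∈q (λ { refl → contradiction (unique r r₀) λ () }) , r

module _ {n} {P : Fin n → Set} (P? : U.Decidable P) where

  comprehension : Subset n
  comprehension = tabulate (does ∘ P?)

  ∈comprehension⁺ : ∀ {x} → P x → x ∈ comprehension
  ∈comprehension⁺ {x} px =
    lookup⇒[]= x _ (trans (lookup∘tabulate _ x) (dec-true (P? x) px))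

  ∈comprehension⁻ : ∀ {x} → x ∈ comprehension → P x
  ∈comprehension⁻ {x} x∈
    with P? x | trans (sym (lookup∘tabulate (does ∘ P?) x)) ([]=⇒lookup x∈)
  ... | yes px | _ = px

-- Codes of unordered edges.

-- The endpoints are sorted because `Subgraph` stores an edge with its smaller endpoint first. A
-- loop would get a diagonal code, hence the assumption `u ≢ v` in `edge⁻`.
edge : ∀ {n} → Fin n → Fin n → Fin (n * n)
edge u v with u <? v
... | yes _ = combine u v
... | no  _ = combine v u

edge-cases : ∀ {n} (u v : Fin n) → edge u v ≡ combine u v ⊎ edge u v ≡ combine v u
edge-cases u v with u <? v
... | yes _ = inj₁ refl
... | no  _ = inj₂ refl

edge-injective : ∀ {n} (u v u′ v′ : Fin n) → edge u v ≡ edge u′ v′ →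
                 (u ≡ u′ × v ≡ v′) ⊎ (u ≡ v′ × v ≡ u′)
edge-injective u v u′ v′ eq with u <? v | u′ <? v′
... | yes _ | yes _ = inj₁ (combine-injective u v u′ v′ eq)
... | yes _ | no  _ = inj₂ (combine-injective u v v′ u′ eq)
... | no  _ | yes _ = let (a , b) = combine-injective v u u′ v′ eq in inj₂ (b , a)
... | no  _ | no  _ = let (a , b) = combine-injective v u v′ u′ eq in inj₁ (b , a)

edge⁻ : ∀ {n} {u v a b : Fin n} → u ≢ v → edge u v ≡ combine a b →
        a <ᶠ b × ((u ≡ a × v ≡ b) ⊎ (u ≡ b × v ≡ a))
edge⁻ {u = u} {v} {a} {b} u≢v eq with u <? v
... | yes u<v with combine-injective u v a b eq
...   | refl , refl = u<v , inj₁ (refl , refl)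
edge⁻ {u = u} {v} {a} {b} u≢v eq | no u≮v with combine-injective v u a b eq
...   | refl , refl with <-cmp u v
...     | tri< u<v _ _ = contradiction u<v u≮v
...     | tri≈ _ u≡v _ = contradiction u≡v u≢v
...     | tri> _ _ v<u = v<u , inj₂ (refl , refl)

edge-joined : ∀ {n} {E : Subset (n * n)} (u v : Fin n) → edge u v ∈ E → Joined E u v
edge-joined {E = E} u v e∈ =
  Sum.map (λ eq → subst (_∈ E) eq e∈) (λ eq → subst (_∈ E) eq e∈) (edge-cases u v)

-- Rooted spanning trees as parent maps.

-- A tree on `S` rooted at `r`, given by parent pointers; values outside `S` are junk. `depth` need
-- not be the distance to `r`: it certifies that following parents ends, and `root-least` allows any
-- vertex other than `r` to be moved below the root without changing depths.
record ParentMap {n} (R : Rel (Fin n) 0ℓ) (S : Subset n) (r : Fin n) : Set where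
  field
    parent     : Fin n → Fin n
    depth      : Fin n → ℕ
    root-least : ∀ {u} → u ∈ S → depth r ≤ depth u
    step       : ∀ {u} → u ∈ S → u ≢ r → R u (parent u)
    closed     : ∀ {u} → u ∈ S → u ≢ r → parent u ∈ S
    descends   : ∀ {u} → u ∈ S → u ≢ r → depth (parent u) < depth u

  -- Two vertices with the same edge to the parent would be each other's parents.
  parent-edge-injective : ∀ {u v} → u ∈ S → u ≢ r → v ∈ S → v ≢ r →
                          edge u (parent u) ≡ edge v (parent v) → u ≡ v
  parent-edge-injective {u} {v} u∈ u≢r v∈ v≢r eq
    with edge-injective u (parent u) v (parent v) eq
  ... | inj₁ (u≡v , _)  = u≡v
  ... | inj₂ (u≡pv , pu≡v) = contradiction
    (subst (λ x → depth x < depth u) pu≡v (descends u∈ u≢r))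
    (ℕ.<-asym (subst (λ x → depth x < depth v) (sym u≡pv) (descends v∈ v≢r)))

module _ {n} {R : Rel (Fin n) 0ℓ} (R? : Decidable R) {S : Subset n} {r : Fin n} where

  private
    Reaches : ℕ → Fin n → Set
    Reaches zero    u = u ≡ r
    Reaches (suc k) u = ∃[ w ] R u w × Reaches k w

    reaches? : ∀ k → U.Decidable (Reaches k)
    reaches? zero    u = u ≟ r
    reaches? (suc k) u = any? λ w → R? u w ×-dec reaches? k w

    reaches : ∀ {u} (p : Star R u r) → Reaches (length p) u
    reaches ε       = refl
    reaches (e ◅ p) = _ , e , reaches p

  -- The depth is the distance to `r` along `R`, and the parent is the second vertex of a shortest
  -- walk to `r`.
  breadthFirst : r ∈ S → (∀ u w → R u w → w ∈ S) → (∀ {u} → u ∈ S → Star R u r) →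
                 ParentMap R S r
  breadthFirst r∈S R⇒∈S walk = record
    { parent     = proj₁ ∘ up
    ; depth      = proj₁ ∘ distance
    ; root-least = λ _ → ℕ.≤-trans (proj₂ (proj₂ (distance r) r∈S) 0 refl) z≤n
    ; step       = λ u∈ u≢ → proj₁ (proj₂ (up _) u∈ u≢)
    ; closed     = λ u∈ u≢ → R⇒∈S _ _ (proj₁ (proj₂ (up _) u∈ u≢))
    ; descends   = λ u∈ u≢ → proj₂ (proj₂ (up _) u∈ u≢)
    }
    where
    distance : ∀ u → ∃[ k ] (u ∈ S → Reaches k u × (∀ j → Reaches j u → k ≤ j))
    distance u with u ∈? S
    ... | no u∉  = 0 , λ u∈ → contradiction u∈ u∉
    ... | yes u∈ with least (λ k → reaches? k u) _ (reaches (walk u∈))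
    ...   | k , reach , min = k , λ _ → reach , min

    up : ∀ u → ∃[ w ] (u ∈ S → u ≢ r → R u w × proj₁ (distance w) < proj₁ (distance u))
    up u with distance u
    -- A vertex of `S` at distance 0 is `r` itself, so `u` is only a dummy parent here.
    ... | zero  , d = u , λ u∈ u≢r → contradiction (proj₁ (d u∈)) u≢r
    ... | suc k , d with u ∈? S
    ...   | no u∉  = u , λ u∈ → contradiction u∈ u∉
    ...   | yes u∈ with proj₁ (d u∈)
    -- The rest of the walk takes `w` to `r` in `k` steps, so the distance of `w` is at most `k`.
    ...     | w , e , reach = w , λ _ _ → e , s≤s (proj₂ (proj₂ (distance w) (R⇒∈S u w e)) k reach)

-- Subgraphs and parent maps; pruning a dominated vertex.

module _ {F : Graph} where

  module _ {S : Subset (order F)} {r : Vertex F} (r∈S : r ∈ S)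
           (φ : ParentMap (Adj F) S r) where

    open ParentMap φ

    private
      IsTreeEdge : Fin (order F * order F) → Set
      IsTreeEdge e = ∃[ u ] u ∈ S - r × edge u (parent u) ≡ e

      isTreeEdge? : U.Decidable IsTreeEdge
      isTreeEdge? e = any? λ u → (u ∈? S - r) ×-dec (edge u (parent u) ≟ e)

      E : Subset (order F * order F)
      E = comprehension isTreeEdge?

      valid : ∀ u v → combine u v ∈ E → u <ᶠ v × Adj F u v × u ∈ S × v ∈ S
      valid a b e∈ with ∈comprehension⁻ isTreeEdge? e∈
      ... | u , u∈- , eq with p─q⊆p S _ u∈- | x∈p-y⇒x≢y u∈-
      ...   | u∈ | u≢r
        with step u∈ u≢r | closed u∈ u≢r
           | edge⁻ (λ u≡p → Graph.irrefl F u≡p (step u∈ u≢r)) eq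
      ...     | adj | p∈ | a<b , inj₁ (refl , refl) = a<b , adj , u∈ , p∈
      ...     | adj | p∈ | a<b , inj₂ (refl , refl) = a<b , Graph.symm F adj , p∈ , u∈

      toRoot : ∀ u → u ∈ S → Acc _<_ (depth u) → Star (Joined E) u r
      toRoot u u∈ (acc rec) with u ≟ r
      ... | yes refl = ε
      ... | no u≢r   =
        edge-joined u (parent u)
          (∈comprehension⁺ isTreeEdge? (u , x∈p∧x≢y⇒x∈p-y u∈ u≢r , refl))
        ◅ toRoot (parent u) (closed u∈ u≢r) (rec (descends u∈ u≢r))

    parentTree : Subgraph F
    parentTree = record { verts = S ; edges = E ; valid = valid }

    parentTree-connected : ConnectedSubgraph parentTree
    parentTree-connected u v u∈ v∈ =
      toRoot u u∈ (<-wellFounded _) ◅◅ reverse swap (toRoot v v∈ (<-wellFounded _))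

    -- Every edge of the tree is the parent edge of some non-root vertex, and that vertex determines
    -- the edge.
    parentTree-size : size parentTree ≤ ∣ S - r ∣
    parentTree-size = left-unique⇒∣∣≤ {R = λ e u → edge u (parent u) ≡ e} E (S - r)
      (∈comprehension⁻ isTreeEdge?) (λ eq eq′ → trans (sym eq) eq′)

  module _ (T : Subgraph F) where

    joined-adj : ∀ u v → Joined {order F} (edges T) u v → Adj F u v
    joined-adj u v (inj₁ e) = proj₁ (proj₂ (Subgraph.valid T _ _ e))
    joined-adj u v (inj₂ e) = Graph.symm F (proj₁ (proj₂ (Subgraph.valid T _ _ e)))

    joined-∈ʳ : ∀ u v → Joined {order F} (edges T) u v → v ∈ verts T
    joined-∈ʳ u v (inj₁ e) = proj₂ (proj₂ (proj₂ (Subgraph.valid T _ _ e)))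
    joined-∈ʳ u v (inj₂ e) = proj₁ (proj₂ (proj₂ (Subgraph.valid T _ _ e)))

    joined-edge : ∀ u v → Joined {order F} (edges T) u v → edge u v ∈ edges T
    joined-edge u v j with u <? v | j
    ... | yes _   | inj₁ e = e
    ... | yes u<v | inj₂ e = contradiction (proj₁ (Subgraph.valid T _ _ e)) (<ᶠ-asym u<v)
    ... | no u≮v  | inj₁ e = contradiction (proj₁ (Subgraph.valid T _ _ e)) u≮v
    ... | no _    | inj₂ e = e

    walk-∈verts : ∀ {u v w} (p : Star (Joined {order F} (edges T)) u v) → u ∈ verts T →
                  w ∈ˡ vertices p → w ∈ verts T
    walk-∈verts ε u∈ (here refl) = u∈
    walk-∈verts (_ ◅ _) u∈ (here refl) = u∈
    walk-∈verts {u} (_◅_ {j = v} j p) u∈ (there w∈) = walk-∈verts p (joined-∈ʳ u v j) w∈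

    joined? : Decidable (Joined {order F} (edges T))
    joined? u v = (combine u v ∈? edges T) ⊎-dec (combine v u ∈? edges T)

    -- A connected subgraph has at least one edge fewer than vertices: distinct non-root vertices
    -- have distinct parent edges.
    parents-size : ∀ {r} → ParentMap (Joined {order F} (edges T)) (verts T) r →
                   ∣ verts T - r ∣ ≤ size T
    parents-size {r} φ =
      -- Membership is built into the relation because `parent-edge-injective` speaks only of
      -- non-root vertices of the tree.
      left-unique⇒∣∣≤ {R = λ u e → u ∈ verts T - r × edge u (parent u) ≡ e}
        (verts T - r) (edges T)
        (λ {u} u∈- → edge u (parent u) ,
          joined-edge u (parent u) (step (p─q⊆p (verts T) _ u∈-) (x∈p-y⇒x≢y u∈-)) , u∈- , refl)
        (λ { (u∈- , eq) (v∈- , eq′) → parent-edge-injective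
               (p─q⊆p (verts T) _ u∈-) (x∈p-y⇒x≢y u∈-)
               (p─q⊆p (verts T) _ v∈-) (x∈p-y⇒x≢y v∈-) (trans eq (sym eq′)) })
      where open ParentMap φ

    -- The saving is counted through vertices: the new tree has at most as many edges as `V - x - r`
    -- has elements, which is fewer than `V - r` has, and the latter bounds `size T` from below.
    prune : ConnectedSubgraph T → ∀ {r x} → r ∈ verts T → x ∈ verts T → r ≢ x →
            (∀ {u} → Adj F u x → u ≢ r → Adj F u r) →
            Σ (Subgraph F) λ T′ → ConnectedSubgraph T′ × verts T′ ≡ verts T - x ×
                                  size T′ < size T
    prune conn {r} {x} r∈ x∈ r≢x dominated =
      parentTree r∈′ ψ , parentTree-connected r∈′ ψ , refl ,
      ℕ.≤-<-trans (parentTree-size r∈′ ψ)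
        (ℕ.<-≤-trans
          (subst (λ p → ∣ p ∣ < ∣ V - r ∣) (p─x─y≡p─y─x V r x)
            (x∈p⇒∣p-x∣<∣p∣ (x∈p∧x≢y⇒x∈p-y x∈ (r≢x ∘ sym))))
          (parents-size φ))
      where
      V = verts T

      φ : ParentMap (Joined {order F} (edges T)) V r
      φ = breadthFirst joined? r∈ joined-∈ʳ (λ u∈ → conn _ _ u∈ r∈)

      open ParentMap φ

      r∈′ : r ∈ V - x
      r∈′ = x∈p∧x≢y⇒x∈p-y r∈ r≢x

      rehang : ∀ u → ∃[ w ] (u ∈ V → u ≢ r → Adj F u w × w ∈ V - x × depth w < depth u)
      rehang u with parent u ≟ x
      ... | no p≢x   = parent u , λ u∈ u≢r →
        joined-adj u _ (step u∈ u≢r) , x∈p∧x≢y⇒x∈p-y (closed u∈ u≢r) p≢x , descends u∈ u≢r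
      -- A child of `x` is moved to `r`. The old depths still descend, since `r` is no deeper than
      -- `x`.
      ... | yes p≡x = r , λ u∈ u≢r →
        dominated (subst (Adj F u) p≡x (joined-adj u _ (step u∈ u≢r))) u≢r , r∈′ ,
        ℕ.≤-<-trans (root-least (closed u∈ u≢r)) (descends u∈ u≢r)

      hung : ∀ {u} → u ∈ V - x → u ≢ r →
             let w = proj₁ (rehang u) in Adj F u w × w ∈ V - x × depth w < depth u
      hung u∈ = proj₂ (rehang _) (p─q⊆p V _ u∈)

      ψ : ParentMap (Adj F) (V - x) r
      ψ = record
        { parent     = proj₁ ∘ rehang
        ; depth      = depth
        ; root-least = λ u∈ → root-least (p─q⊆p V _ u∈)
        ; step       = λ u∈ u≢r → proj₁ (hung u∈ u≢r)
        ; closed     = λ u∈ u≢r → proj₁ (proj₂ (hung u∈ u≢r))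
        ; descends   = λ u∈ u≢r → proj₂ (proj₂ (hung u∈ u≢r))
        }

  -- Were `x` not in `W`, pruning it would leave a smaller connected subgraph that still contains
  -- `W`.
  dominated-∈terminals : ∀ {W T} → IsSteinerTree F W T → ∀ {r x} → r ∈ verts T →
    x ∈ verts T → r ≢ x → (∀ {u} → Adj F u x → u ≢ r → Adj F u r) → x ∈ W
  dominated-∈terminals {W} {T} (conn , W⊆T , min) {r} {x} r∈ x∈ r≢x dominated =
    decidable-stable (x ∈? W) λ x∉W →
      let (T′ , conn′ , verts≡ , smaller) = prune T conn r∈ x∈ r≢x dominated
          W⊆T′ = λ {w} w∈ → subst (w ∈_) (sym verts≡)
                   (x∈p∧x≢y⇒x∈p-y (W⊆T w∈) λ { refl → x∉W w∈ })
      in ℕ.<⇒≱ smaller (min T′ conn′ W⊆T′)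

-- Existence of shortest paths.

shortestPath : ∀ {n} {R : Rel (Fin n) 0ℓ} → Decidable R → ∀ {u v} → Star R u v →
               Σ (Star R u v) IsShortestPath
shortestPath R? {u} {v} p
  with least (λ k → anyPath? R? {Q = λ xs → List.length xs ≡ k}
                      (λ xs → List.length xs ℕ.≟ k) u v)
             _ (let (q , uq) = toPath R? p in q , uq , refl)
... | _ , (q , uq , refl) , min = q , uq , λ q′ uq′ →
  -- The search minimises the number of vertices, which exceeds the length by one.
  ℕ.≤-pred (subst₂ _≤_ (length-vertices q) (length-vertices q′) (min _ (q′ , uq′ , refl)))

-- Steiner sets of the corona product.

module _ (G H : Graph) where

  private
    F : Graph
    F = G ⊙ H

    fromView : CoronaVertex G H → Vertex F
    fromView (inj₁ i)       = i ↑ˡ (order G * order H)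
    fromView (inj₂ (i , h)) = order G ↑ʳ combine i h

    view-fromView : ∀ c → coronaView G H (fromView c) ≡ c
    view-fromView (inj₁ i) = cong (Sum.map₂ _) (splitAt-↑ˡ (order G) i _)
    view-fromView (inj₂ (i , h)) =
      trans (cong (Sum.map₂ _) (splitAt-↑ʳ (order G) _ (combine i h)))
            (cong inj₂ (remQuot-combine i h))

    fromView-view : ∀ x → fromView (coronaView G H x) ≡ x
    fromView-view x = trans (go (splitAt (order G) x)) (join-splitAt (order G) _ x)
      where
      go : ∀ s → fromView (Sum.map₂ (remQuot (order H)) s) ≡ join (order G) _ s
      go (inj₁ i) = refl
      go (inj₂ k) = cong (order G ↑ʳ_) (combine-remQuot {order G} (order H) k)

    centre : CoronaVertex G H → Vertex G
    centre (inj₁ i)       = i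
    centre (inj₂ (i , _)) = i

    baseOf : Vertex F → Vertex G
    baseOf = centre ∘ coronaView G H

    root : Vertex G → Vertex F
    root = fromView ∘ inj₁

    copy : Vertex G → Vertex H → Vertex F
    copy i h = fromView (inj₂ (i , h))

    baseOf-copy : ∀ i h → baseOf (copy i h) ≡ i
    baseOf-copy i h = cong centre (view-fromView (inj₂ (i , h)))

    -- All neighbours of a vertex in a copy have the same centre as that vertex.
    leaves-from-root : ∀ c d → CoronaAdj G H c d → centre d ≢ centre c → c ≡ inj₁ (centre c)
    leaves-from-root (inj₁ i) _        _       _   = refl
    leaves-from-root (inj₂ _) (inj₁ _) e       d≢c = contradiction (sym e) d≢c
    leaves-from-root (inj₂ _) (inj₂ _) (e , _) d≢c = contradiction (sym e) d≢c

    -- The first edge of the walk that changes `baseOf` starts at the root. `R` is general so that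
    -- this serves both walks inside a Steiner tree and paths of `F`.
    exits-through-root : ∀ {R : Rel (Vertex F) 0ℓ} → (∀ u v → R u v → Adj F u v) →
      ∀ {x y} (p : Star R x y) → baseOf y ≢ baseOf x → root (baseOf x) ∈ˡ vertices p
    exits-through-root R⇒Adj ε y≢x = contradiction refl y≢x
    exits-through-root R⇒Adj {x} {y} (_◅_ {j = z} e p) y≢x with baseOf z ≟ baseOf x
    ... | yes z≡x = there (subst (λ i → root i ∈ˡ vertices p) z≡x
                      (exits-through-root R⇒Adj p λ y≡z → y≢x (trans y≡z z≡x)))
    ... | no z≢x  = here (trans (sym (cong fromView x-is-root)) (fromView-view x))
      where
      x-is-root = leaves-from-root (coronaView G H x) (coronaView G H z) (R⇒Adj x z e) z≢x

    root≢copy : ∀ {i j h} → root i ≢ copy j h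
    root≢copy {i} {j} {h} eq
      with trans (sym (view-fromView (inj₁ i)))
                 (trans (cong (coronaView G H) eq) (view-fromView (inj₂ (j , h))))
    ... | ()

    -- Besides `root i`, a vertex of copy `i` has neighbours only in its own copy, and `root i` is
    -- joined to all of that copy. This is the hypothesis of `prune`.
    copy-dominated : ∀ i h {u} → Adj F u (copy i h) → u ≢ root i → Adj F u (root i)
    copy-dominated i h {u} e u≢
      rewrite view-fromView (inj₁ i) | view-fromView (inj₂ (i , h))
      with coronaView G H u | fromView-view u
    ... | inj₁ j       | u≡ = contradiction (trans (sym u≡) (cong root e)) u≢
    ... | inj₂ (j , k) | _  = proj₁ e

  module _ {W : Subset (order F)} (steiner : IsSteinerSet F W) where

    private
      copy-∈-if-met-outside : ∀ {w} → w ∈ W → ∀ i h → baseOf w ≢ i → copy i h ∈ W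
      copy-∈-if-met-outside {w} w∈ i h w≢i with proj₂ steiner (copy i h)
      -- `T` is a Steiner tree through `copy i h`. Its walk from there to `w` must pass `root i`.
      ... | T , tree@(conn , W⊆T , _) , x∈ =
        dominated-∈terminals {F} {W} {T} tree root∈ x∈ root≢copy
          (λ {u} → copy-dominated i h {u})
        where
        walk : Star (Joined {order F} (edges T)) (copy i h) w
        walk = conn _ _ x∈ (W⊆T w∈)
        root∈ : root i ∈ verts T
        root∈ = walk-∈verts T walk x∈
          (subst (λ j → root j ∈ˡ vertices walk) (baseOf-copy i h)
            (exits-through-root (joined-adj T) walk λ eq → w≢i (trans eq (baseOf-copy i h))))

    steinerSet-⊇-copies : (∀ i → ∃[ j ] j ≢ i) → ∀ i h → copy i h ∈ W
    steinerSet-⊇-copies other i h with proj₁ steiner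
    ... | w , w∈ with baseOf w ≟ i
    ...   | no w≢i   = copy-∈-if-met-outside w∈ i h w≢i
    ...   | yes refl with other (baseOf w)
    -- The inner application puts `copy j h` into `W`; it then replaces `w` as the element outside
    -- copy `i`.
    ...     | j , j≢i = copy-∈-if-met-outside (copy-∈-if-met-outside w∈ j h (j≢i ∘ sym)) i h
                          (λ eq → j≢i (trans (sym (baseOf-copy j h)) eq))

    steinerSet-geodetic : Connected G → Vertex H → (∀ i → ∃[ j ] j ≢ i) → IsGeodeticSet F W
    steinerSet-geodetic conn h other = proj₁ steiner , covered
      where
      copies = steinerSet-⊇-copies other

      covered : ∀ w → ∃[ u ] ∃[ v ] u ∈ W × v ∈ W × InInterval F u v w
      covered w with coronaView G H w | fromView-view w
      ... | inj₂ (i , k) | refl =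
        -- A vertex of a copy lies in `W` and is covered by the trivial path.
        w , w , copies i k , copies i k , ε , ([] ∷ [] , λ _ _ → z≤n) , here refl
      ... | inj₁ i | refl with other i
      ...   | j , j≢i with shortestPath (Graph.adj? F) (⊙-connected G H conn (copy i h) (copy j h))
      -- Any shortest path between two different copies will do, as each walk out of copy `i`
      -- contains `root i`.
      ...     | p , shortest =
        copy i h , copy j h , copies i h , copies j h , p , shortest ,
        subst (λ l → root l ∈ˡ vertices p) (baseOf-copy i h)
          (exits-through-root (λ _ _ e → e) p λ eq →
            j≢i (trans (sym (baseOf-copy j h)) (trans eq (baseOf-copy i h))))

-- Choice of vertices and the inequality.

someVertex : (G : Graph) → Vertex G
someVertex G = pick (order G)
  where
  pick : ∀ n → {{NonZero n}} → Fin n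
  pick (suc _) = zero

anotherFin : ∀ {n} → 2 ≤ n → ∀ (i : Fin n) → ∃[ j ] j ≢ i
anotherFin (s≤s (s≤s _)) zero    = suc zero , λ ()
anotherFin (s≤s (s≤s _)) (suc _) = zero , λ ()

theorem24 : (G H : Graph) (G-connected : Connected G) → 2 ≤ order G → ¬ Complete H →
    geodeticNumber (G ⊙ H) ≤ steinerNumber (G ⊙ H) (⊙-connected G H G-connected)
theorem24 G H conn 2≤n _ =
  let (_ , geodetic-least) = proj₂ (geodetic-minimum (G ⊙ H))
      ((W , steiner , ∣W∣≡s) , _) = proj₂ (steiner-minimum (G ⊙ H) (⊙-connected G H conn))
  in subst (geodeticNumber (G ⊙ H) ≤_) ∣W∣≡s
       (geodetic-least W
         (steinerSet-geodetic G H steiner conn (someVertex H) (anotherFin 2≤n)))
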